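{- Let $\ell,r\ge1$ be integers and let $p$ be a divisor of $r$ that does not divide $\ell$. Let $\mathtt{A}^{\pm}_p(\ell,r)$ be the number of attractors of period $p$ of the canonical negative-positive double Boolean automata circuit $D_{\ell,r}$ (negative left-circuit of size $\ell$, positive right-circuit of size $r$), and let $$\mathtt{A}^+_p=\frac1p\sum_{d\mid p}\mu\!\left(\frac pd\right)2^d .$$ If $p\ne2$, then $$\mathtt{A}^{\pm}_p(\ell,r)<2\cdot\left(\frac{\sqrt3}{2}\right)^p\cdot\mathtt{A}^+_p,$$ and if $p=2$, then $\mathtt{A}^{\pm}_2(\ell,r)=1=\mathtt{A}^+_2$.
   Context: The canonical negative-positive double Boolean automata circuit $D_{\ell,r}$ has $n=\ell+r-1$ nodes $0,\ldots,n-1$. For a configuration $x=(x_0,\ldots,x_{n-1})\in\{0,1\}^n$ write $x^L=(x_0,\ldots,x_{\ell-1})$ (states of the left-circuit) and $x^R=(x_0,x_\ell,\ldots,x_{n-1})$ (states of the right-circuit, $r$ entries). All nodes are updated in parallel by $F:\{0,1\}^n\to\{0,1\}^n$: $F(x)_i=x_{i-1}$ for $i\notin\{0,\ell\}$; $F(x)_\ell=x_0$ (if $r\ge2$); and $F(x)_0=\neg a\vee b$, where $a=x_{\ell-1}$ is the last entry of $x^L$ and $b$ is the last entry of $x^R$ (so $b=x_{n-1}$ when $r\ge 2$). A configuration $x$ has period $p$ if $F^{p}(x)=x$; it has exact period $p$ if moreover it has no period $d<p$, $d\ge1$. An attractor of period $p$ is the orbit under $F$ of a configuration of exact period $p$.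 $\mu$ is the Möbius function. The number $\mathtt{A}^+_p$ is the number of attractors of period $p$ of an isolated positive Boolean automata circuit whose size is a multiple of $p$. -}

module Defs where

open import Data.Bool using (Bool; true; false; not; _∨_; if_then_else_)
import Data.Bool.Properties as Bool
open import Data.Fin using (Fin; zero; suc; toℕ; fromℕ<)
import Data.Fin as Fin
open import Data.Fin.Properties using (toℕ<n)
open import Data.Integer using (ℤ; +_; -[1+_])
import Data.Integer as ℤ
open import Data.List using (List; []; _∷_; [_]; length; lookup; map; filter; foldr;
  upTo; deduplicate; cartesianProductWith)
open import Data.List.Membership.Propositional using (_∈_)
open import Data.List.Membership.Propositional.Properties
  using (∈-cartesianProductWith⁺; ∈-lookup)
import Data.List.Relation.Unary.All as All
open import Data.List.Relation.Unary.AllPairs using (AllPairs; _∷_)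
open import Data.List.Relation.Unary.Any using (here; there)
open import Data.List.Relation.Unary.Enumerates.Setoid using (IsEnumeration)
open import Data.List.Relation.Unary.Enumerates.Setoid.Properties
  using (deduplicate⁺; lookup-surjective)
open import Data.List.Relation.Unary.Unique.DecSetoid.Properties using (deduplicate-!)
open import Data.List.Relation.Unary.Unique.DecPropositional using (unique?)
open import Data.Nat using (ℕ; zero; suc; _+_; _*_; _∸_; _^_; _≤_; _<_; s≤s; NonZero;
  >-nonZero⁻¹; _≡ᵇ_; _≟_; _/_; _%_)
import Data.Nat.DivMod as DivMod
open import Data.Nat.Divisibility using (_∣?_)
open import Data.Nat.Primality.Factorisation using (factorise; factors)
open import Data.Nat.Properties using (≤-trans; <-≤-trans; ≤-reflexive; m≤m+n; +-monoʳ-<; +-assoc;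
  +-∸-assoc; m∸n+n≡m; <⇒≤; allUpTo?; anyUpTo?; _≤?_)
open import Data.Product using (∃; ∃-syntax; _×_; _,_; proj₁; proj₂)
open import Data.Rational using (ℚ; 0ℚ; 1ℚ)
import Data.Rational as ℚ
open import Data.Vec using (Vec; []; _∷_; tabulate; last)
import Data.Vec as Vec
import Data.Vec.Properties as Vec
open import Function using (_⇔_; mk⇔; Equivalence; Bijection; _∘_)
import Function.Endo.Propositional as Endo
open import Level using (0ℓ)
open import Relation.Binary using (DecSetoid)
import Relation.Binary.PropositionalEquality as ≡
open import Relation.Binary.PropositionalEquality using (_≡_; refl; sym; trans; cong)
open import Relation.Nullary using (¬_; Dec; yes; no; contradiction; does)
open import Relation.Nullary.Decidable using (_×-dec_; ¬?; map′; _→-dec_)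

lookup-injective : ∀ {a} {A : Set a} {R : A → A → Set} → (∀ {x y} → R x y → R y x) →
  ∀ {xs} → AllPairs (λ x y → ¬ R x y) xs →
  ∀ {i j} → R (lookup xs i) (lookup xs j) → i ≡ j
lookup-injective s (p ∷ ps) {zero}  {zero}  r = refl
lookup-injective s (p ∷ ps) {zero}  {suc j} r = contradiction r (All.lookup p (∈-lookup j))
lookup-injective s (p ∷ ps) {suc i} {zero}  r = contradiction (s r) (All.lookup p (∈-lookup i))
lookup-injective s (p ∷ ps) {suc i} {suc j} r = cong suc (lookup-injective s ps r)

lastEntry : ∀ {m} .{{_ : NonZero m}} → Vec Bool m → Bool
lastEntry {suc _} = last

boolVecs : ∀ n → List (Vec Bool n)
boolVecs zero    = [ [] ]
boolVecs (suc n) = cartesianProductWith _∷_ (false ∷ true ∷ []) (boolVecs n)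

∈-boolVecs : ∀ {n} (v : Vec Bool n) → v ∈ boolVecs n
∈-boolVecs []          = here refl
∈-boolVecs (false ∷ v) = ∈-cartesianProductWith⁺ _∷_ {xs = false ∷ true ∷ []} (here refl) (∈-boolVecs v)
∈-boolVecs (true  ∷ v) = ∈-cartesianProductWith⁺ _∷_ {xs = false ∷ true ∷ []} (there (here refl)) (∈-boolVecs v)

module DoubleCircuit (ℓ r : ℕ) .{{_ : NonZero ℓ}} .{{_ : NonZero r}} where

  n : ℕ
  n = ℓ + r ∸ 1

  Config : Set
  Config = Vec Bool n

  n≡ : n ≡ ℓ + (r ∸ 1)
  n≡ = +-∸-assoc ℓ {r} {1} (>-nonZero⁻¹ r)

  ℓ≤n : ℓ ≤ n
  ℓ≤n = ≤-trans (m≤m+n ℓ (r ∸ 1)) (≤-reflexive (sym n≡))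

  right< : ∀ {s} → s < r ∸ 1 → ℓ + s < n
  right< s< = <-≤-trans (+-monoʳ-< ℓ s<) (≤-reflexive (sym n≡))

  suc<⇒<pred : ∀ {m k} → suc m < k → m < k ∸ 1
  suc<⇒<pred (s≤s m<) = m<

  leftNode : Fin ℓ → Fin n
  leftNode i = fromℕ< (<-≤-trans (toℕ<n i) ℓ≤n)

  node₀ : Fin n
  node₀ = fromℕ< (<-≤-trans (>-nonZero⁻¹ ℓ) ℓ≤n)

  -- Node 0, followed by nodes ℓ, …, n - 1.
  rightNode′ : ∀ k → k < r → Fin n
  rightNode′ zero    _   = node₀
  rightNode′ (suc k) k<r = fromℕ< (right< (suc<⇒<pred k<r))

  rightNode : Fin r → Fin n
  rightNode i = rightNode′ (toℕ i) (toℕ<n i)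

  left : Config → Vec Bool ℓ
  left x = tabulate (Vec.lookup x ∘ leftNode)

  right : Config → Vec Bool r
  right x = tabulate (Vec.lookup x ∘ rightNode)

  -- If r = 1 there is no node ℓ, and the second branch is never taken.
  update : Config → Fin n → Bool
  update x i =
    if toℕ i ≡ᵇ 0 then not (lastEntry (left x)) ∨ lastEntry (right x)
    else if toℕ i ≡ᵇ ℓ then Vec.lookup x node₀
    else Vec.lookup x (Fin.pred i)

  F : Config → Config
  F x = tabulate (update x)

  open Endo Config using (^-homo) renaming (_^_ to _^ᶠ_)

  HasPeriod : ℕ → Config → Set
  HasPeriod p x = (F ^ᶠ p) x ≡ x

  HasExactPeriod : ℕ → Config → Set
  HasExactPeriod p x = HasPeriod p x × (∀ {d} → d < p → 1 ≤ d → ¬ HasPeriod d x)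

  Orbit : Config → Config → Set
  Orbit x y = ∃[ k ] (F ^ᶠ k) x ≡ y

  _≟ᶜ_ : (x y : Config) → Dec (x ≡ y)
  _≟ᶜ_ = Vec.≡-dec Bool._≟_

  hasExactPeriod? : ∀ p x → Dec (HasExactPeriod p x)
  hasExactPeriod? p x = ((F ^ᶠ p) x ≟ᶜ x) ×-dec
    allUpTo? (λ d → (1 ≤? d) →-dec ¬? ((F ^ᶠ d) x ≟ᶜ x)) p

  iter-+ : ∀ a b x → (F ^ᶠ (a + b)) x ≡ (F ^ᶠ a) ((F ^ᶠ b) x)
  iter-+ a b x = cong (λ f → f x) (^-homo F a b)

  iter-* : ∀ {p x} → HasPeriod p x → ∀ q → HasPeriod (q * p) x
  iter-* h zero = refl
  iter-* {p} {x} h (suc q) =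
    trans (iter-+ p (q * p) x) (trans (cong (F ^ᶠ p) (iter-* h q)) h)

  iter-% : ∀ {p x} .{{_ : NonZero p}} → HasPeriod p x →
           ∀ k → (F ^ᶠ (k % p)) x ≡ (F ^ᶠ k) x
  iter-% {p} {x} h k =
    trans (cong (F ^ᶠ (k % p)) (sym (iter-* h (k / p))))
      (trans (sym (iter-+ (k % p) (k / p * p) x))
        (cong (λ j → (F ^ᶠ j) x) (sym (DivMod.m≡m%n+[m/n]*n k p))))

  -- An attractor is represented by any of its points.  Two representatives
  -- are identified when their orbits are equal as sets.
  module _ (p : ℕ) .{{_ : NonZero p}} where

    SameOrbit : Config → Config → Set
    SameOrbit x y = ∀ z → Orbit x z ⇔ Orbit y z

    sameOrbit? : ∀ {x y} → HasPeriod p x → Dec (SameOrbit x y)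
    sameOrbit? {x} {y} h = map′ to from (anyUpTo? (λ k → (F ^ᶠ k) x ≟ᶜ y) p)
      where
      to : (∃[ k ] k < p × (F ^ᶠ k) x ≡ y) → SameOrbit x y
      to (k , k<p , refl) z = mk⇔
        (λ { (j , refl) → j + (p ∸ k) ,
             trans (sym (iter-+ (j + (p ∸ k)) k x))
               (trans (cong (λ m → (F ^ᶠ m) x)
                        (trans (+-assoc j (p ∸ k) k)
                               (cong (_+_ j) (m∸n+n≡m (<⇒≤ k<p)))))
                 (trans (iter-+ j p x) (cong (F ^ᶠ j) h))) })
        (λ { (j , refl) → j + k , iter-+ j k x })

      from : SameOrbit x y → ∃[ k ] k < p × (F ^ᶠ k) x ≡ y
      from s with k , eq ← Equivalence.from (s y) (0 , refl) =
        k % p , DivMod.m%n<n k p , trans (iter-% h k) eq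

    attractors : DecSetoid 0ℓ 0ℓ
    attractors = record
      { Carrier = ∃ (HasExactPeriod p)
      ; _≈_ = λ x y → SameOrbit (proj₁ x) (proj₁ y)
      ; isDecEquivalence = record
        { isEquivalence = record
          { refl  = λ z → mk⇔ (λ o → o) (λ o → o)
          ; sym   = λ s z → mk⇔ (Equivalence.from (s z)) (Equivalence.to (s z))
          ; trans = λ s t z → mk⇔ (Equivalence.to (t z) ∘ Equivalence.to (s z))
                                  (Equivalence.from (s z) ∘ Equivalence.from (t z))
          }
        ; _≟_ = λ x y → sameOrbit? (proj₁ (proj₂ x))
        }
      }

    open DecSetoid attractors using (setoid) renaming (_≟_ to _≟ᵒ_)

    representatives : List Config → List (∃ (HasExactPeriod p))
    representatives []       = []
    representatives (c ∷ cs) with hasExactPeriod? p c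
    ... | yes e = (c , e) ∷ representatives cs
    ... | no  _ = representatives cs

    representatives-complete : IsEnumeration setoid (representatives (boolVecs n))
    representatives-complete (x , e) = go (∈-boolVecs x)
      where
      open import Data.List.Membership.Setoid setoid using () renaming (_∈_ to _∈ᵒ_)
      go : ∀ {cs} → x ∈ cs → (x , e) ∈ᵒ representatives cs
      go {c ∷ cs} (here refl) with hasExactPeriod? p c
      ... | yes e′ = here (λ z → mk⇔ (λ o → o) (λ o → o))
      ... | no ¬e  = contradiction e ¬e
      go {c ∷ cs} (there x∈) with hasExactPeriod? p c
      ... | yes _ = there (go x∈)
      ... | no  _ = go x∈

    attractorList : List (∃ (HasExactPeriod p))
    attractorList = deduplicate _≟ᵒ_ (representatives (boolVecs n))

    attractorCount : ℕ
    attractorCount = length attractorList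

    attractorCount-correct : Bijection (≡.setoid (Fin attractorCount)) setoid
    attractorCount-correct = record
      { to = lookup attractorList
      ; cong = λ { {i} refl → DecSetoid.refl attractors {lookup attractorList i} }
      ; bijective =
          lookup-injective (λ {x} {y} → DecSetoid.sym attractors {x} {y})
            (deduplicate-! attractors (representatives (boolVecs n)))
        , lookup-surjective setoid (deduplicate⁺ attractors representatives-complete)
      }

A± : (p ℓ r : ℕ) .{{_ : NonZero p}} .{{_ : NonZero ℓ}} .{{_ : NonZero r}} → ℕ
A± p ℓ r = DoubleCircuit.attractorCount ℓ r p

-- The value at 0 is a convention; it is never used.
μ : ℕ → ℤ
μ zero        = + 0
μ m@(suc _) = if does (unique? _≟_ (factors (factorise m)))
              then -[1+ 0 ] ℤ.^ length (factors (factorise m))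
              else + 0

-- The index i stands for the divisor d = suc i.
möbiusTerm : ℕ → ℕ → ℤ
möbiusTerm p i = μ (p / suc i) ℤ.* + (2 ^ suc i)

A⁺ : (p : ℕ) .{{_ : NonZero p}} → ℚ
A⁺ p = foldr ℤ._+_ (+ 0) (map (möbiusTerm p) (filter (λ i → suc i ∣? p) (upTo p))) ℚ./ p

infix 5 _+√3·_

-- The ordered subfield ℚ(√3) of ℝ: a +√3· b is the real number a + b√3.
record ℚ√3 : Set where
  constructor _+√3·_
  field
    rat : ℚ
    irr : ℚ

open ℚ√3 public

fromℚ : ℚ → ℚ√3
fromℚ a = a +√3· 0ℚ

fromℕ : ℕ → ℚ√3
fromℕ k = fromℚ (+ k ℚ./ 1)

√3 : ℚ√3
√3 = 0ℚ +√3· 1ℚ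

infixl 6 _⊖_
infixl 7 _⊗_
infixr 8 _↑_
infix 4 _⊏_

_⊖_ : ℚ√3 → ℚ√3 → ℚ√3
(a +√3· b) ⊖ (c +√3· d) = (a ℚ.- c) +√3· (b ℚ.- d)

_⊗_ : ℚ√3 → ℚ√3 → ℚ√3
(a +√3· b) ⊗ (c +√3· d) =
  (a ℚ.* c ℚ.+ (+ 3 ℚ./ 1) ℚ.* (b ℚ.* d)) +√3· (a ℚ.* d ℚ.+ b ℚ.* c)

_↑_ : ℚ√3 → ℕ → ℚ√3
x ↑ zero  = fromℕ 1
x ↑ suc k = x ⊗ x ↑ k

-- a + b√3 is positive exactly when its summand of larger absolute value is
-- positive; |a| = |b|√3 only happens for a = b = 0.
data Positive : ℚ√3 → Set where
  rat-dominates : ∀ {a b} → 0ℚ ℚ.< a → (+ 3 ℚ./ 1) ℚ.* (b ℚ.* b) ℚ.< a ℚ.* a →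
                  Positive (a +√3· b)
  irr-dominates : ∀ {a b} → 0ℚ ℚ.< b → a ℚ.* a ℚ.< (+ 3 ℚ./ 1) ℚ.* (b ℚ.* b) →
                  Positive (a +√3· b)

_⊏_ : ℚ√3 → ℚ√3 → Set
x ⊏ y = Positive (y ⊖ x)

√3²≡3 : √3 ⊗ √3 ≡ fromℕ 3
√3²≡3 = refl

{-# OPTIONS --safe #-}

-- On a configuration of period p ∣ r, the state u of node 0 over time satisfies
-- u(t + ℓ) = ¬ u(t) ∨ u(t + ℓ), so it is a cyclic word of length p without two
-- zeros at distance ℓ.  The p constraints (i , i + ℓ) use every position of the
-- word exactly twice and each allows 3 of 4 pairs of values, so by the
-- Loomis–Whitney inequality there are at most √3 ^ p such words.  An attractor
-- accounts for p of them, whence p · A± ≤ √3 ^ p.  On the other side, for p ≥ 3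
-- the term d = p dominates the Möbius sum: p · A⁺ > 2 ^ (p - 1).

module Submission where

open import Defs
open import Data.Bool using (Bool; true; false; _∨_; not; if_then_else_)
import Data.Bool.Properties as Bool
open import Data.Fin using (Fin; zero; suc; toℕ; fromℕ<; punchIn; punchOut; remQuot; combine)
import Data.Fin as Fin
open import Data.Fin.Properties using (toℕ-fromℕ<; toℕ-fromℕ; toℕ-injective; toℕ<n;
  punchInᵢ≢i; punchIn-injective; punchIn-punchOut; combine-remQuot)
import Data.Fin.Properties as Fin
open import Data.Integer using (ℤ; +_; -[1+_])
import Data.Integer as ℤ
import Data.Integer.Properties as ℤ
import Data.Integer.Tactic.RingSolver as ℤSolver
open import Data.List using (List; []; _∷_; _++_; length; map; filter; foldr; upTo)
import Data.List as List
open import Data.List.Properties using (upTo-∷ʳ; filter-++; map-++; foldr-++; filter-accept;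
  filter-reject; length-tabulate)
open import Data.List.Relation.Unary.All as All using (All; []; _∷_)
import Data.List.Relation.Unary.All.Properties as All
open import Data.List.Relation.Unary.AllPairs using ([]; _∷_)
open import Data.List.Relation.Unary.Unique.DecPropositional using (unique?)
open import Data.List.Relation.Unary.Unique.Propositional using (Unique)
import Data.List.Relation.Unary.Unique.Propositional.Properties as Unique
open import Data.Maybe using (Maybe; just; nothing)
open import Data.Nat
open import Data.Nat.DivMod
open import Data.Nat.Divisibility using (_∣_; divides; _∣?_; ∣m+n∣m⇒∣n; ∣-refl; ∣1⇒≡1; 1∣_)
open import Data.Nat.Primality.Factorisation using (factorise; factors)
open import Data.Nat.Properties
open import Data.Nat.Tactic.RingSolver using (solve-∀)
open import Data.Product using (Σ-syntax; ∃-syntax; _×_; _,_; proj₁; proj₂; uncurry)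
open import Data.Rational using (ℚ; 0ℚ; 1ℚ; ½)
import Data.Rational as ℚ
import Data.Rational.Properties as ℚ
open import Data.Rational.Solver using (module +-*-Solver)
open import Data.Rational.Unnormalised using (mkℚᵘ)
import Data.Rational.Unnormalised as ℚᵘ
import Data.Rational.Unnormalised.Properties as ℚᵘ
open import Data.Sum using (_⊎_; inj₁; inj₂)
open import Data.Vec using (Vec; lookup; tabulate; last)
open import Data.Vec.Functional using (Vector; removeAt; updateAt)
open import Data.Vec.Functional.Properties using (updateAt-updates; updateAt-minimal)
open import Data.Vec.Properties using (lookup∘tabulate; tabulate∘lookup; tabulate-cong)
open import Function using (_∘_; const; id; mk⇔; _⇔_; Bijection)
open import Function.Construct.Composition using (_⇔-∘_)
open import Function.Construct.Symmetry using (⇔-sym)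
import Function.Endo.Propositional as Endo
open import Relation.Binary using (tri<; tri≈; tri>)
open import Relation.Binary.PropositionalEquality
open import Relation.Nullary using (¬_; Dec; yes; no; does; contradiction)
open import Relation.Nullary.Decidable using (dec-true; dec-false)
open import Algebra.Properties.CommutativeMonoid.Sum *-1-commutativeMonoid
  using () renaming (sum to ∏; sum-remove to ∏-remove; sum-cong-≗ to ∏-cong)

-- The Loomis–Whitney bound

2xy≤x²+y² : ∀ x y → 2 * (x * y) ≤ x * x + y * y
2xy≤x²+y² x y with ≤-total x y
... | inj₁ x≤y with d , refl ← m≤n⇒∃[o]m+o≡n x≤y =
  ≤-trans (m≤m+n _ (d * d)) (≤-reflexive (identity x d))
  where
  identity : ∀ x d → 2 * (x * (x + d)) + d * d ≡ x * x + (x + d) * (x + d)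
  identity = solve-∀
... | inj₂ y≤x with d , refl ← m≤n⇒∃[o]m+o≡n y≤x =
  ≤-trans (m≤m+n _ (d * d)) (≤-reflexive (identity y d))
  where
  identity : ∀ y d → 2 * ((y + d) * y) + d * d ≡ (y + d) * (y + d) + y * y
  identity = solve-∀

square-cancel-≤ : ∀ {m n} → m * m ≤ n * n → m ≤ n
square-cancel-≤ m²≤n² = ≮⇒≥ λ n<m → ≤⇒≯ m²≤n² (*-mono-< n<m n<m)

-- (√(s t) + √(s′ t′))² ≤ (s + s′) (t + t′), scaled by R.
cauchy-schwarz : ∀ a b s s′ t t′ {R} → a * a ≤ s * (t * R) → b * b ≤ s′ * (t′ * R) →
  (a + b) * (a + b) ≤ (s + s′) * ((t + t′) * R)
cauchy-schwarz a b s s′ t t′ {R} a²≤ b²≤ = begin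
  (a + b) * (a + b)                             ≡⟨ expand a b ⟩
  a * a + b * b + 2 * (a * b)
    ≤⟨ +-mono-≤ (+-mono-≤ a²≤ b²≤) (square-cancel-≤ 4a²b²≤) ⟩
  s * (t * R) + s′ * (t′ * R) + (X + Y)         ≡⟨ collect s s′ t t′ R ⟩
  (s + s′) * ((t + t′) * R)                     ∎
  where
  open ≤-Reasoning
  X Y : ℕ
  X = s * t′ * R
  Y = s′ * t * R
  expand : ∀ a b → (a + b) * (a + b) ≡ a * a + b * b + 2 * (a * b)
  expand = solve-∀
  collect : ∀ s s′ t t′ R → s * (t * R) + s′ * (t′ * R) + (s * t′ * R + s′ * t * R) ≡
    (s + s′) * ((t + t′) * R)
  collect = solve-∀
  square : ∀ a b → 2 * (a * b) * (2 * (a * b)) ≡ 4 * ((a * a) * (b * b))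
  square = solve-∀
  regroup : ∀ s s′ t t′ R → 4 * ((s * (t * R)) * (s′ * (t′ * R))) ≡
    2 * ((s * t′ * R) * (s′ * t * R)) + 2 * ((s * t′ * R) * (s′ * t * R))
  regroup = solve-∀
  unsquare : ∀ X Y → X * X + Y * Y + 2 * (X * Y) ≡ (X + Y) * (X + Y)
  unsquare = solve-∀
  4a²b²≤ : 2 * (a * b) * (2 * (a * b)) ≤ (X + Y) * (X + Y)
  4a²b²≤ = begin
    2 * (a * b) * (2 * (a * b))               ≡⟨ square a b ⟩
    4 * ((a * a) * (b * b))                   ≤⟨ *-monoʳ-≤ 4 (*-mono-≤ a²≤ b²≤) ⟩
    4 * ((s * (t * R)) * (s′ * (t′ * R)))     ≡⟨ regroup s s′ t t′ R ⟩
    2 * (X * Y) + 2 * (X * Y)                 ≤⟨ +-monoˡ-≤ _ (2xy≤x²+y² X Y) ⟩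
    X * X + Y * Y + 2 * (X * Y)               ≡⟨ unsquare X Y ⟩
    (X + Y) * (X + Y)                         ∎

∏-remove₂ : ∀ {n} {i j : Fin n} → i ≢ j → ∃[ m ] Σ[ rest ∈ (Fin m → Fin n) ]
  (∀ k → rest k ≢ i × rest k ≢ j) × (∀ f → ∏ f ≡ f i * (f j * ∏ (f ∘ rest)))
∏-remove₂ {suc zero}    {zero} {zero} i≢j = contradiction refl i≢j
∏-remove₂ {suc (suc m)} {i}    {j}    i≢j =
  m , (λ k → punchIn i (punchIn j′ k)) , avoids , splits
  where
  j′ : Fin (suc m)
  j′ = punchOut i≢j
  avoids : ∀ k → punchIn i (punchIn j′ k) ≢ i × punchIn i (punchIn j′ k) ≢ j
  avoids k = punchInᵢ≢i i _ , λ eq → punchInᵢ≢i j′ k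
    (punchIn-injective i _ _ (trans eq (sym (punchIn-punchOut i≢j))))
  splits : ∀ f → ∏ f ≡ f i * (f j * ∏ (λ k → f (punchIn i (punchIn j′ k))))
  splits f = trans (∏-remove {i = i} f) (cong (f i *_)
    (trans (∏-remove {i = j′} (removeAt f i))
      (cong (λ j → f j * ∏ (f ∘ punchIn i ∘ punchIn j′)) (punchIn-punchOut i≢j))))

cauchy-schwarz-∏ : ∀ {n} a b {i j : Fin n} {f g h : Vector ℕ n} → i ≢ j →
  f i ≡ g i + h i → f j ≡ g j + h j →
  (∀ k → k ≢ i → k ≢ j → g k ≡ f k × h k ≡ f k) →
  a * a ≤ ∏ g → b * b ≤ ∏ h → (a + b) * (a + b) ≤ ∏ f
cauchy-schwarz-∏ a b {i} {j} {f} {g} {h} i≢j fi fj same a²≤ b²≤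
  with m , rest , avoids , splits ← ∏-remove₂ i≢j = begin
  (a + b) * (a + b)                                ≤⟨ cauchy-schwarz a b (g i) (h i) (g j) (h j)
                                                       (bound a g proj₁ a²≤) (bound b h proj₂ b²≤) ⟩
  (g i + h i) * ((g j + h j) * ∏ (f ∘ rest))       ≡⟨ cong₂ (λ x y → x * (y * ∏ (f ∘ rest))) fi fj ⟨
  f i * (f j * ∏ (f ∘ rest))                       ≡⟨ splits f ⟨
  ∏ f                                              ∎
  where
  open ≤-Reasoning
  bound : ∀ c e → (∀ {k} → g k ≡ f k × h k ≡ f k → e k ≡ f k) →
    c * c ≤ ∏ e → c * c ≤ e i * (e j * ∏ (f ∘ rest))
  bound c e pick c²≤ = begin
    c * c                        ≤⟨ c²≤ ⟩
    ∏ e                          ≡⟨ splits e ⟩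
    e i * (e j * ∏ (e ∘ rest))   ≡⟨ cong (λ R → e i * (e j * R)) (∏-cong λ k →
                                      pick (same (rest k) (proj₁ (avoids k)) (proj₂ (avoids k)))) ⟩
    e i * (e j * ∏ (f ∘ rest))   ∎

lookup-ext : ∀ {A : Set} {n} {v w : Vec A n} → (∀ i → lookup v i ≡ lookup w i) → v ≡ w
lookup-ext {v = v} {w} eq =
  trans (sym (tabulate∘lookup v)) (trans (tabulate-cong eq) (tabulate∘lookup w))

1≤∏ : ∀ {n} {f : Vector ℕ n} → (∀ i → 1 ≤ f i) → 1 ≤ ∏ f
1≤∏ {zero}  1≤f = ≤-refl
1≤∏ {suc n} 1≤f = *-mono-≤ (1≤f zero) (1≤∏ (1≤f ∘ suc))

compatible : Maybe Bool → Bool → ℕ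
compatible nothing      _     = 1
compatible (just false) false = 1
compatible (just false) true  = 0
compatible (just true)  false = 0
compatible (just true)  true  = 1

-- The number of (a , b) with a ∨ b ≡ true extending the partial values x and y.
pairs : Maybe Bool → Maybe Bool → ℕ
pairs x y = compatible x true * compatible y true
          + compatible x true * compatible y false
          + compatible x false * compatible y true

pairs-splitˡ : ∀ y → pairs nothing y ≡ pairs (just false) y + pairs (just true) y
pairs-splitˡ nothing      = refl
pairs-splitˡ (just false) = refl
pairs-splitˡ (just true)  = refl

pairs-splitʳ : ∀ x → pairs x nothing ≡ pairs x (just false) + pairs x (just true)
pairs-splitʳ nothing      = refl
pairs-splitʳ (just false) = refl
pairs-splitʳ (just true)  = refl

1≤pairs : ∀ a b → a ∨ b ≡ true → 1 ≤ pairs (just a) (just b)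
1≤pairs false true  _ = ≤-refl
1≤pairs true  false _ = ≤-refl
1≤pairs true  true  _ = ≤-refl

length-partition : ∀ {A : Set} (f : A → Bool) xs →
  length xs ≡ length (filter (λ x → f x Bool.≟ false) xs) + length (filter (λ x → f x Bool.≟ true) xs)
length-partition f []       = refl
length-partition f (x ∷ xs) with f x
... | false = cong suc (length-partition f xs)
... | true  = trans (cong suc (length-partition f xs)) (sym (+-suc _ _))

module _ {n} (σ σ⁻¹ : Fin n → Fin n) (σ∘σ⁻¹ : ∀ i → σ (σ⁻¹ i) ≡ i) (σ⁻¹∘σ : ∀ i → σ⁻¹ (σ i) ≡ i)
  (σ-fixfree : ∀ i → σ i ≢ i) where

  σ⁻¹-fixfree : ∀ i → σ⁻¹ i ≢ i
  σ⁻¹-fixfree i eq = σ-fixfree i (trans (cong σ (sym eq)) (σ∘σ⁻¹ i))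

  Valid : Vec Bool n → Set
  Valid w = ∀ i → lookup w i ∨ lookup w (σ i) ≡ true

  _⊨_ : Vec Bool n → Vector (Maybe Bool) n → Set
  w ⊨ ρ = ∀ i {b} → ρ i ≡ just b → lookup w i ≡ b

  weight : Vector (Maybe Bool) n → Vector ℕ n
  weight ρ i = pairs (ρ i) (ρ (σ i))

  assign : Vector (Maybe Bool) n → Fin n → Bool → Vector (Maybe Bool) n
  assign ρ j b = updateAt ρ j (const (just b))

  assign-⊨ : ∀ w {ρ j b} → w ⊨ ρ → lookup w j ≡ b → w ⊨ assign ρ j b
  assign-⊨ w {ρ} {j} {b} w⊨ρ wj i eq with i Fin.≟ j
  ... | yes refl with refl ← trans (sym (updateAt-updates i ρ)) eq = wj
  ... | no i≢j = w⊨ρ i (trans (sym (updateAt-minimal i j ρ i≢j)) eq)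

  weight-split : ∀ ρ j → ρ j ≡ nothing → ∀ i → i ≡ j ⊎ i ≡ σ⁻¹ j →
    weight ρ i ≡ weight (assign ρ j false) i + weight (assign ρ j true) i
  weight-split ρ j ρj i (inj₁ refl)
    rewrite updateAt-updates j {const (just false)} ρ | updateAt-updates j {const (just true)} ρ
          | updateAt-minimal (σ j) j {const (just false)} ρ (σ-fixfree j)
          | updateAt-minimal (σ j) j {const (just true)} ρ (σ-fixfree j)
          | ρj = pairs-splitˡ (ρ (σ j))
  weight-split ρ j ρj i (inj₂ refl)
    rewrite σ∘σ⁻¹ j
          | updateAt-updates j {const (just false)} ρ | updateAt-updates j {const (just true)} ρ
          | updateAt-minimal (σ⁻¹ j) j {const (just false)} ρ (σ⁻¹-fixfree j)
          | updateAt-minimal (σ⁻¹ j) j {const (just true)} ρ (σ⁻¹-fixfree j)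
          | ρj = pairs-splitʳ (ρ (σ⁻¹ j))

  weight-other : ∀ ρ j b i → i ≢ j → i ≢ σ⁻¹ j → weight (assign ρ j b) i ≡ weight ρ i
  weight-other ρ j b i i≢j i≢σ⁻¹j = cong₂ pairs
    (updateAt-minimal i j ρ i≢j)
    (updateAt-minimal (σ i) j ρ λ { refl → i≢σ⁻¹j (sym (σ⁻¹∘σ i)) })

  FreeBelow : ℕ → Vector (Maybe Bool) n → Set
  FreeBelow k ρ = (∀ i → toℕ i < k → ρ i ≡ nothing) × (∀ i → k ≤ toℕ i → ∃[ b ] ρ i ≡ just b)

  assign-freeBelow : ∀ {k ρ} (k<n : k < n) b → FreeBelow (suc k) ρ →
    FreeBelow k (assign ρ (fromℕ< k<n) b)
  assign-freeBelow {k} {ρ} k<n b (free , bound) = free′ , bound′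
    where
    free′ : ∀ i → toℕ i < k → assign ρ (fromℕ< k<n) b i ≡ nothing
    free′ i i<k = trans
      (updateAt-minimal i _ ρ λ { refl → <⇒≢ i<k (toℕ-fromℕ< k<n) })
      (free i (m<n⇒m<1+n i<k))
    bound′ : ∀ i → k ≤ toℕ i → ∃[ c ] assign ρ (fromℕ< k<n) b i ≡ just c
    bound′ i k≤i with i Fin.≟ fromℕ< k<n
    ... | yes refl = b , updateAt-updates i ρ
    ... | no i≢k with c , eq ← bound i (≤∧≢⇒< k≤i λ { refl → i≢k (sym (Fin.fromℕ<-toℕ i k<n)) }) =
      c , trans (updateAt-minimal i _ ρ i≢k) eq

  -- Fixing the value at one more position j splits exactly two of the weights,
  -- those at j and σ⁻¹ j; Cauchy–Schwarz recombines the two halves.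
  length²≤∏weight : ∀ k → k ≤ n → ∀ ρ → FreeBelow k ρ → ∀ ws → Unique ws → All Valid ws →
    All (_⊨ ρ) ws → length ws * length ws ≤ ∏ (weight ρ)
  length²≤∏weight zero _ ρ _ [] _ _ _ = z≤n
  length²≤∏weight zero _ ρ (_ , bound) (w ∷ []) _ (valid ∷ _) (w⊨ρ ∷ _) =
    1≤∏ λ i → subst (1 ≤_) (sym (cong₂ pairs (value i) (value (σ i))))
      (1≤pairs (lookup w i) (lookup w (σ i)) (valid i))
    where
    value : ∀ i → ρ i ≡ just (lookup w i)
    value i with c , eq ← bound i z≤n = trans eq (cong just (sym (w⊨ρ i eq)))
  length²≤∏weight zero _ ρ (_ , bound) (w ∷ w′ ∷ _) ((w≢w′ ∷ _) ∷ _) _ (w⊨ρ ∷ w′⊨ρ ∷ _) =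
    contradiction (lookup-ext λ i → let ρi = proj₂ (bound i z≤n) in
      trans (w⊨ρ i ρi) (sym (w′⊨ρ i ρi))) w≢w′
  length²≤∏weight (suc k) k<n ρ free ws unique valid ws⊨ρ =
    subst (λ l → l * l ≤ ∏ (weight ρ)) (sym (length-partition (λ w → lookup w j) ws))
      (cauchy-schwarz-∏
        (length (filter (λ w → lookup w j Bool.≟ false) ws))
        (length (filter (λ w → lookup w j Bool.≟ true) ws)) {i = j} {j = σ⁻¹ j}
        (λ eq → σ⁻¹-fixfree j (sym eq))
        (weight-split ρ j ρj j (inj₁ refl)) (weight-split ρ j ρj (σ⁻¹ j) (inj₂ refl))
        (λ i i≢j i≢σ⁻¹j → weight-other ρ j false i i≢j i≢σ⁻¹j , weight-other ρ j true i i≢j i≢σ⁻¹j)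
        (half false) (half true))
    where
    j : Fin n
    j = fromℕ< k<n
    ρj : ρ j ≡ nothing
    ρj = proj₁ free j (≤-reflexive (cong suc (toℕ-fromℕ< k<n)))
    half : ∀ b → let ws′ = filter (λ w → lookup w j Bool.≟ b) ws in
      length ws′ * length ws′ ≤ ∏ (weight (assign ρ j b))
    half b = length²≤∏weight k (<⇒≤ k<n) (assign ρ j b) (assign-freeBelow k<n b free) _
      (Unique.filter⁺ j≟b unique) (All.filter⁺ j≟b valid)
      (All.zipWith (λ {w} (w⊨ρ , wj) → assign-⊨ w {ρ} w⊨ρ wj)
        (All.filter⁺ j≟b ws⊨ρ , All.all-filter j≟b ws))
      where
      j≟b : ∀ w → Dec (lookup w j ≡ b)
      j≟b w = lookup w j Bool.≟ b

  length²≤3^n : ∀ {ws} → Unique ws → All Valid ws → length ws * length ws ≤ 3 ^ n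
  length²≤3^n {ws} unique valid = subst (length ws * length ws ≤_) (∏-const n)
    (length²≤∏weight n ≤-refl (const nothing)
      ((λ _ _ → refl) , λ i n≤i → contradiction (toℕ<n i) (≤⇒≯ n≤i)) ws unique valid
      (All.universal (λ w i ()) ws))
    where
    ∏-const : ∀ m → ∏ {m} (const 3) ≡ 3 ^ m
    ∏-const zero    = refl
    ∏-const (suc m) = cong (3 *_) (∏-const m)

-- The circuit as a delayed recurrence for node 0

if-yes : ∀ {P A : Set} (P? : Dec P) {a b : A} → P → (if does P? then a else b) ≡ a
if-yes P? p rewrite dec-true P? p = refl

if-no : ∀ {P A : Set} (P? : Dec P) {a b : A} → ¬ P → (if does P? then a else b) ≡ b
if-no P? ¬p rewrite dec-false P? ¬p = refl

toℕ-pred : ∀ {n} (i : Fin n) → toℕ (Fin.pred i) ≡ pred (toℕ i)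
toℕ-pred zero    = refl
toℕ-pred (suc i) = Fin.toℕ-inject₁ i

last-tabulate : ∀ {A : Set} {m} (f : Fin (suc m) → A) → last (tabulate f) ≡ f (Fin.fromℕ m)
last-tabulate {m = zero}  f = refl
last-tabulate {m = suc m} f = last-tabulate (f ∘ suc)

module Dynamics (ℓ′ r′ : ℕ) where

  ℓ r : ℕ
  ℓ = suc ℓ′
  r = suc r′

  open DoubleCircuit ℓ r
  open Endo Config using () renaming (_^_ to _^ᶠ_)

  lastLeft lastRight : Fin n
  lastLeft = leftNode (Fin.fromℕ ℓ′)
  lastRight = rightNode (Fin.fromℕ r′)

  F-zero : ∀ x {i} → toℕ i ≡ 0 → lookup (F x) i ≡ not (lookup x lastLeft) ∨ lookup x lastRight
  F-zero x {i} i≡0 = begin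
    lookup (F x) i                               ≡⟨ lookup∘tabulate (update x) i ⟩
    update x i                                   ≡⟨ if-yes (toℕ i ≟ 0) i≡0 ⟩
    not (last (left x)) ∨ last (right x)
      ≡⟨ cong₂ (λ a b → not a ∨ b)
           (last-tabulate (lookup x ∘ leftNode)) (last-tabulate (lookup x ∘ rightNode)) ⟩
    not (lookup x lastLeft) ∨ lookup x lastRight ∎
    where open ≡-Reasoning

  F-ℓ : ∀ x {i} → toℕ i ≡ ℓ → lookup (F x) i ≡ lookup x node₀
  F-ℓ x {i} i≡ℓ = trans (lookup∘tabulate (update x) i)
    (trans (if-no (toℕ i ≟ 0) λ i≡0 → 0≢1+n (trans (sym i≡0) i≡ℓ))
      (if-yes (toℕ i ≟ ℓ) i≡ℓ))

  F-pred : ∀ x {i} → toℕ i ≢ 0 → toℕ i ≢ ℓ → lookup (F x) i ≡ lookup x (Fin.pred i)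
  F-pred x {i} i≢0 i≢ℓ = trans (lookup∘tabulate (update x) i)
    (trans (if-no (toℕ i ≟ 0) i≢0)
      (if-no (toℕ i ≟ ℓ) i≢ℓ))

  toℕ-node₀ : toℕ node₀ ≡ 0
  toℕ-node₀ = toℕ-fromℕ< _

  -- The distance from node 0 to node m.
  delay : ℕ → ℕ
  delay m = if does (m <? ℓ) then m else suc (m ∸ ℓ)

  delay-< : ∀ {m} → m < ℓ → delay m ≡ m
  delay-< {m} m<ℓ = if-yes (m <? ℓ) m<ℓ

  delay-≥ : ∀ s → delay (ℓ + s) ≡ suc s
  delay-≥ s = trans (if-no (ℓ + s <? ℓ) (m+n≮m ℓ s))
    (cong suc (m+n∸m≡n ℓ s))

  delay-ℓ : delay ℓ ≡ 1
  delay-ℓ = trans (cong delay (sym (+-identityʳ ℓ))) (delay-≥ 0)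

  delay-suc : ∀ {m} → suc m ≢ ℓ → delay (suc m) ≡ suc (delay m)
  delay-suc {m} m+1≢ℓ with m <? ℓ
  ... | yes m<ℓ = trans (delay-< (≤∧≢⇒< m<ℓ m+1≢ℓ)) (cong suc (sym (delay-< m<ℓ)))
  ... | no m≮ℓ with s , refl ← m≤n⇒∃[o]m+o≡n (≮⇒≥ m≮ℓ) =
    trans (cong delay (sym (+-suc ℓ s))) (trans (delay-≥ (suc s)) (cong suc (sym (delay-≥ s))))

  delay-lastLeft : delay (toℕ lastLeft) ≡ ℓ′
  delay-lastLeft = trans (cong delay (trans (toℕ-fromℕ< _) (toℕ-fromℕ ℓ′))) (delay-< ≤-refl)

  delay-rightNode′ : ∀ k (k<r : k < r) → delay (toℕ (rightNode′ k k<r)) ≡ k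
  delay-rightNode′ zero    _   = trans (cong delay toℕ-node₀) (delay-< z<s)
  delay-rightNode′ (suc s) k<r = trans (cong delay (toℕ-fromℕ< (right< (suc<⇒<pred k<r)))) (delay-≥ s)

  delay-lastRight : delay (toℕ lastRight) ≡ r′
  delay-lastRight = trans (delay-rightNode′ _ (toℕ<n (Fin.fromℕ r′))) (toℕ-fromℕ r′)

  signal : Config → ℕ → Bool
  signal x t = lookup ((F ^ᶠ t) x) node₀

  history : ∀ x t m {i} → toℕ i ≡ m → lookup ((F ^ᶠ (delay m + t)) x) i ≡ signal x t
  history x t zero    i≡m = cong (lookup ((F ^ᶠ t) x)) (toℕ-injective (trans i≡m (sym toℕ-node₀)))
  history x t (suc m) {i} i≡m with suc m ≟ ℓ
  ... | yes refl = trans (cong (λ d → lookup ((F ^ᶠ (d + t)) x) i) delay-ℓ) (F-ℓ ((F ^ᶠ t) x) i≡m)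
  ... | no m+1≢ℓ = begin
    lookup ((F ^ᶠ (delay (suc m) + t)) x) i
      ≡⟨ cong (λ d → lookup ((F ^ᶠ (d + t)) x) i) (delay-suc m+1≢ℓ) ⟩
    lookup (F ((F ^ᶠ (delay m + t)) x)) i
      ≡⟨ F-pred ((F ^ᶠ (delay m + t)) x)
           (λ i≡0 → 0≢1+n (trans (sym i≡0) i≡m)) (m+1≢ℓ ∘ trans (sym i≡m)) ⟩
    lookup ((F ^ᶠ (delay m + t)) x) (Fin.pred i)
      ≡⟨ history x t m (trans (toℕ-pred i) (cong pred i≡m)) ⟩
    signal x t                                    ∎
    where open ≡-Reasoning

  signal-recurrence : ∀ x s → signal x (ℓ + r + s) ≡ not (signal x (r + s)) ∨ signal x (ℓ + s)
  signal-recurrence x s = trans (F-zero ((F ^ᶠ (ℓ′ + r + s)) x) toℕ-node₀)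
    (cong₂ (λ a b → not a ∨ b)
      (at lastLeft (trans (+-assoc ℓ′ r s) (cong (_+ (r + s)) (sym delay-lastLeft))))
      (at lastRight (trans time (cong (_+ (ℓ + s)) (sym delay-lastRight)))))
    where
    at : ∀ i {t t′} → t ≡ delay (toℕ i) + t′ → lookup ((F ^ᶠ t) x) i ≡ signal x t′
    at i {t′ = t′} refl = history x t′ (toℕ i) refl
    time : ℓ′ + r + s ≡ r′ + (ℓ + s)
    time = begin
      ℓ′ + suc r′ + s    ≡⟨ cong (_+ s) (+-suc ℓ′ r′) ⟩
      ℓ + r′ + s         ≡⟨ cong (_+ s) (+-comm ℓ r′) ⟩
      r′ + ℓ + s         ≡⟨ +-assoc r′ ℓ s ⟩
      r′ + (ℓ + s)       ∎
      where open ≡-Reasoning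

  module Periodic (p : ℕ) .{{_ : NonZero p}} where

    signal-% : ∀ {x} → HasPeriod p x → ∀ t → signal x (t % p) ≡ signal x t
    signal-% h t = cong (λ y → lookup y node₀) (iter-% h t)

    signal-injective : ∀ {x y} → HasPeriod p x → HasPeriod p y →
      (∀ t → t < p → signal x t ≡ signal y t) → x ≡ y
    signal-injective {x} {y} hx hy eq = lookup-ext λ i → trans (coordinate hx i)
      (trans (trans (sym (signal-% hx (time i))) (trans (eq _ (m%n<n (time i) p)) (signal-% hy (time i))))
        (sym (coordinate hy i)))
      where
      time : Fin n → ℕ
      time i = delay (toℕ i) * p ∸ delay (toℕ i)
      coordinate : ∀ {z} → HasPeriod p z → ∀ i → lookup z i ≡ signal z (time i)
      coordinate {z} hz i = trans
        (cong (λ y → lookup y i) (trans (sym (iter-* hz d))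
          (cong (λ m → (F ^ᶠ m) z) (sym (m+[n∸m]≡n (m≤m*n d p))))))
        (history z (time i) (toℕ i) refl)
        where d = delay (toℕ i)

    signal-no-adjacent-zeros : p ∣ r → ∀ {x} → HasPeriod p x → ∀ s → signal x s ∨ signal x (s + ℓ) ≡ true
    signal-no-adjacent-zeros (divides q r≡q*p) {x} h s = resolve _ _ (begin
      signal x (s + ℓ)                             ≡⟨ cong (signal x) (+-comm s ℓ) ⟩
      signal x (ℓ + s)                             ≡⟨ shift (ℓ + s) ⟨
      signal x (r + (ℓ + s))
        ≡⟨ cong (signal x) (trans (sym (+-assoc r ℓ s)) (cong (_+ s) (+-comm r ℓ))) ⟩
      signal x (ℓ + r + s)                         ≡⟨ signal-recurrence x s ⟩
      not (signal x (r + s)) ∨ signal x (ℓ + s)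
        ≡⟨ cong₂ (λ a b → not a ∨ signal x b) (shift s) (+-comm ℓ s) ⟩
      not (signal x s) ∨ signal x (s + ℓ)          ∎)
      where
      open ≡-Reasoning
      shift : ∀ t → signal x (r + t) ≡ signal x t
      shift t = trans (cong (λ k → signal x (k + t)) r≡q*p)
        (trans (sym (signal-% h (q * p + t)))
          (trans (cong (signal x) (trans (cong (_% p) (+-comm (q * p) t)) ([m+kn]%n≡m%n t q p)))
            (signal-% h t)))
      resolve : ∀ a b → b ≡ not a ∨ b → a ∨ b ≡ true
      resolve true  b _    = refl
      resolve false b b≡1 = b≡1

module Rotation (p : ℕ) .{{_ : NonZero p}} where

  rotate : ℕ → Fin p → Fin p
  rotate k i = fromℕ< (m%n<n (toℕ i + k) p)

  toℕ-rotate : ∀ k i → toℕ (rotate k i) ≡ (toℕ i + k) % p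
  toℕ-rotate k i = toℕ-fromℕ< (m%n<n (toℕ i + k) p)

  rotate-+ : ∀ a b i → p ∣ a + b → rotate b (rotate a i) ≡ i
  rotate-+ a b i p∣a+b = toℕ-injective (begin
    toℕ (rotate b (rotate a i))              ≡⟨ toℕ-rotate b (rotate a i) ⟩
    (toℕ (rotate a i) + b) % p               ≡⟨ cong (λ m → (m + b) % p) (toℕ-rotate a i) ⟩
    ((toℕ i + a) % p + b) % p                ≡⟨ %-distribˡ-+ ((toℕ i + a) % p) b p ⟩
    ((toℕ i + a) % p % p + b % p) % p
      ≡⟨ cong (λ m → (m + b % p) % p) (m%n%n≡m%n (toℕ i + a) p) ⟩
    ((toℕ i + a) % p + b % p) % p            ≡⟨ %-distribˡ-+ (toℕ i + a) b p ⟨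
    (toℕ i + a + b) % p                      ≡⟨ cong (_% p) (+-assoc (toℕ i) a b) ⟩
    (toℕ i + (a + b)) % p                    ≡⟨ %-remove-+ʳ (toℕ i) p∣a+b ⟩
    toℕ i % p                                ≡⟨ m<n⇒m%n≡m (toℕ<n i) ⟩
    toℕ i                                    ∎)
    where open ≡-Reasoning

  rotate-fixed : ∀ k i → rotate k i ≡ i → p ∣ k
  rotate-fixed k i eq = divides ((toℕ i + k) / p) (+-cancelˡ-≡ (toℕ i) _ _ (begin
    toℕ i + k                                ≡⟨ m≡m%n+[m/n]*n (toℕ i + k) p ⟩
    (toℕ i + k) % p + (toℕ i + k) / p * p
      ≡⟨ cong (_+ (toℕ i + k) / p * p) (trans (sym (toℕ-rotate k i)) (cong toℕ eq)) ⟩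
    toℕ i + (toℕ i + k) / p * p              ∎))
    where open ≡-Reasoning

module Counting (ℓ′ r′ p : ℕ) .{{_ : NonZero p}} where

  open Dynamics ℓ′ r′
  open DoubleCircuit ℓ r
  open Endo Config using () renaming (_^_ to _^ᶠ_)
  open Periodic p
  open Rotation p

  iterate-hasPeriod : ∀ {x} → HasPeriod p x → ∀ k → HasPeriod p ((F ^ᶠ k) x)
  iterate-hasPeriod {x} h k = begin
    (F ^ᶠ p) ((F ^ᶠ k) x)   ≡⟨ iter-+ p k x ⟨
    (F ^ᶠ (p + k)) x        ≡⟨ cong (λ m → (F ^ᶠ m) x) (+-comm p k) ⟩
    (F ^ᶠ (k + p)) x        ≡⟨ iter-+ k p x ⟩
    (F ^ᶠ k) ((F ^ᶠ p) x)   ≡⟨ cong (F ^ᶠ k) h ⟩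
    (F ^ᶠ k) x              ∎
    where open ≡-Reasoning

  iterate-back : ∀ {x} → HasPeriod p x → ∀ {k} → k ≤ p → (F ^ᶠ (p ∸ k)) ((F ^ᶠ k) x) ≡ x
  iterate-back {x} h {k} k≤p =
    trans (sym (iter-+ (p ∸ k) k x)) (trans (cong (λ m → (F ^ᶠ m) x) (m∸n+n≡m k≤p)) h)

  sameOrbit-iterate : ∀ {x} → HasPeriod p x → ∀ {k} → k ≤ p → SameOrbit p x ((F ^ᶠ k) x)
  sameOrbit-iterate {x} h {k} k≤p z = mk⇔
    (λ (j , eq) → j + (p ∸ k) , trans (iter-+ j (p ∸ k) _) (trans (cong (F ^ᶠ j) (iterate-back h k≤p)) eq))
    (λ (j , eq) → j + k , trans (iter-+ j k x) eq)

  exactPeriod-distinct : ∀ {x} → HasExactPeriod p x → ∀ {j k} → j < k → k < p →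
    (F ^ᶠ j) x ≢ (F ^ᶠ k) x
  exactPeriod-distinct {x} (h , minimal) {j} {k} j<k k<p eq = minimal {p ∸ k + j}
    (subst (p ∸ k + j <_) (m∸n+n≡m (<⇒≤ k<p)) (+-monoʳ-< (p ∸ k) j<k))
    (≤-trans (m<n⇒0<n∸m k<p) (m≤m+n (p ∸ k) j))
    (trans (iter-+ (p ∸ k) j x) (trans (cong (F ^ᶠ (p ∸ k)) eq) (iterate-back h (<⇒≤ k<p))))

  exactPeriod-injective : ∀ {x} → HasExactPeriod p x → ∀ {j k} → j < p → k < p →
    (F ^ᶠ j) x ≡ (F ^ᶠ k) x → j ≡ k
  exactPeriod-injective e {j} {k} j<p k<p eq with <-cmp j k
  ... | tri≈ _ j≡k _ = j≡k
  ... | tri< j<k _ _ = contradiction eq (exactPeriod-distinct e j<k k<p)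
  ... | tri> _ _ k<j = contradiction (sym eq) (exactPeriod-distinct e k<j j<p)

  word : Config → Vec Bool p
  word x = tabulate (signal x ∘ toℕ)

  word-injective : ∀ {x y} → HasPeriod p x → HasPeriod p y → word x ≡ word y → x ≡ y
  word-injective {x} {y} hx hy eq = signal-injective hx hy λ t t<p → begin
    signal x t                        ≡⟨ cong (signal x) (toℕ-fromℕ< t<p) ⟨
    signal x (toℕ (fromℕ< t<p))       ≡⟨ lookup∘tabulate (signal x ∘ toℕ) (fromℕ< t<p) ⟨
    lookup (word x) (fromℕ< t<p)      ≡⟨ cong (λ w → lookup w (fromℕ< t<p)) eq ⟩
    lookup (word y) (fromℕ< t<p)      ≡⟨ lookup∘tabulate (signal y ∘ toℕ) (fromℕ< t<p) ⟩
    signal y (toℕ (fromℕ< t<p))       ≡⟨ cong (signal y) (toℕ-fromℕ< t<p) ⟩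
    signal y t                        ∎
    where open ≡-Reasoning

  module _ {N} (representative : Fin N → Config)
    (representative-exact : ∀ a → HasExactPeriod p (representative a))
    (representative-injective : ∀ {a b} → SameOrbit p (representative a) (representative b) → a ≡ b)
    where

    points : Fin (N) → Fin p → Config
    points a k = (F ^ᶠ toℕ k) (representative a)

    points-hasPeriod : ∀ a k → HasPeriod p (points a k)
    points-hasPeriod a k = iterate-hasPeriod (proj₁ (representative-exact a)) (toℕ k)

    points-sameOrbit : ∀ {a b j k} → points a j ≡ points b k →
      SameOrbit p (representative a) (representative b)
    points-sameOrbit {a} {b} {j} {k} eq z =
      ⇔-sym (sameOrbit-iterate (proj₁ (representative-exact b)) (<⇒≤ (toℕ<n k)) z)
        ⇔-∘ subst (λ y → Orbit (representative a) z ⇔ Orbit y z) eq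
              (sameOrbit-iterate (proj₁ (representative-exact a)) (<⇒≤ (toℕ<n j)) z)

    points-injective : ∀ {a b j k} → points a j ≡ points b k → a ≡ b × j ≡ k
    points-injective {a} {b} {j} {k} eq
      with refl ← representative-injective {a} {b} (points-sameOrbit {a} {b} {j} {k} eq) =
      refl , toℕ-injective (exactPeriod-injective (representative-exact a) (toℕ<n j) (toℕ<n k) eq)

    distinctOrbits-bound : p ∣ r → ¬ (p ∣ ℓ) →
      (N * p) * (N * p) ≤ 3 ^ p
    distinctOrbits-bound p∣r p∤ℓ = subst (λ l → l * l ≤ 3 ^ p)
      (length-tabulate (word ∘ uncurry points ∘ remQuot p))
      (length²≤3^n (rotate ℓ) (rotate (pred p * ℓ))
        (λ i → rotate-+ (pred p * ℓ) ℓ i (subst (p ∣_) (+-comm ℓ (pred p * ℓ)) p∣ℓ+[p-1]ℓ))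
        (λ i → rotate-+ ℓ (pred p * ℓ) i p∣ℓ+[p-1]ℓ)
        (λ i → p∤ℓ ∘ rotate-fixed ℓ i)
        (Unique.tabulate⁺ λ {i} {j} → words-injective {i} {j})
        (All.tabulate⁺ λ i → word-valid (uncurry points-hasPeriod (remQuot {N} p i))))
      where
      p∣ℓ+[p-1]ℓ : p ∣ ℓ + pred p * ℓ
      p∣ℓ+[p-1]ℓ = divides ℓ (trans (cong (_* ℓ) (suc-pred p)) (*-comm p ℓ))

      words-injective : ∀ {i j} → word (uncurry points (remQuot p i)) ≡
        word (uncurry points (remQuot p j)) → i ≡ j
      words-injective {i} {j} eq
        with a≡b , j≡k ← points-injective (word-injective
               (uncurry points-hasPeriod (remQuot {N} p i))
               (uncurry points-hasPeriod (remQuot {N} p j)) eq)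
        = trans (sym (combine-remQuot {N} p i))
            (trans (cong₂ combine a≡b j≡k) (combine-remQuot {N} p j))

      word-valid : ∀ {x} → HasPeriod p x → ∀ i → lookup (word x) i ∨ lookup (word x) (rotate ℓ i) ≡ true
      word-valid {x} h i = begin
        lookup (word x) i ∨ lookup (word x) (rotate ℓ i)
          ≡⟨ cong₂ _∨_ (lookup∘tabulate (signal x ∘ toℕ) i)
               (lookup∘tabulate (signal x ∘ toℕ) (rotate ℓ i)) ⟩
        signal x (toℕ i) ∨ signal x (toℕ (rotate ℓ i))
          ≡⟨ cong (λ t → signal x (toℕ i) ∨ signal x t) (toℕ-rotate ℓ i) ⟩
        signal x (toℕ i) ∨ signal x ((toℕ i + ℓ) % p)
          ≡⟨ cong (signal x (toℕ i) ∨_) (signal-% h (toℕ i + ℓ)) ⟩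
        signal x (toℕ i) ∨ signal x (toℕ i + ℓ)
          ≡⟨ signal-no-adjacent-zeros p∣r h (toℕ i) ⟩
        true                                                    ∎
        where open ≡-Reasoning

  attractorCount-bound : p ∣ r → ¬ (p ∣ ℓ) →
    (attractorCount p * p) * (attractorCount p * p) ≤ 3 ^ p
  attractorCount-bound = distinctOrbits-bound {attractorCount p}
    (λ a → proj₁ (List.lookup (attractorList p) a))
    (λ a → proj₂ (List.lookup (attractorList p) a))
    (Bijection.injective (attractorCount-correct p))

inhabited-prop⇒≡1 : ∀ {n} → Fin n → (∀ (i j : Fin n) → i ≡ j) → n ≡ 1
inhabited-prop⇒≡1 {suc zero}    _ _    = refl
inhabited-prop⇒≡1 {suc (suc n)} _ prop with () ← prop zero (suc zero)

toggle : Bool → ℕ → Bool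
toggle b zero    = b
toggle b (suc m) = not (toggle b m)

toggle-not : ∀ b m → toggle (not b) m ≡ not (toggle b m)
toggle-not b zero    = refl
toggle-not b (suc m) = cong not (toggle-not b m)

toggle-even : ∀ b q → toggle b (q * 2) ≡ b
toggle-even b zero    = refl
toggle-even b (suc q) = trans (Bool.not-involutive _) (toggle-even b q)

toggle-odd : ∀ b m → ¬ (2 ∣ m) → toggle b m ≡ not b
toggle-odd b zero          2∤m = contradiction (divides 0 refl) 2∤m
toggle-odd b (suc zero)    2∤m = refl
toggle-odd b (suc (suc m)) 2∤m = trans (Bool.not-involutive _)
  (toggle-odd b m λ { (divides q eq) → 2∤m (divides (suc q) (cong (λ m → 2 + m) eq)) })

module Alternating (ℓ′ r′ : ℕ) (2∣r : 2 ∣ suc r′) (2∤ℓ : ¬ (2 ∣ suc ℓ′)) where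

  open Dynamics ℓ′ r′
  open DoubleCircuit ℓ r
  open Endo Config using () renaming (_^_ to _^ᶠ_)
  open Periodic 2
  open Counting ℓ′ r′ 2

  signal-changes : ∀ {x} → HasExactPeriod 2 x → signal x 1 ≡ not (signal x 0)
  signal-changes {x} (h , minimal) = Bool.¬-not λ s₁≡s₀ →
    minimal {1} (s≤s (s≤s z≤n)) ≤-refl (signal-injective {F x} {x} (iterate-hasPeriod h 1) h λ where
      0 _ → s₁≡s₀
      1 _ → trans (cong (λ y → lookup y node₀) h) (sym s₁≡s₀)
      (suc (suc _)) (s≤s (s≤s ())))

  sameOrbit : ∀ {x y} → HasExactPeriod 2 x → HasExactPeriod 2 y → SameOrbit 2 x y
  sameOrbit {x} {y} ex ey with signal x 0 Bool.≟ signal y 0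
  ... | yes eq = subst (SameOrbit 2 x) (signal-injective (proj₁ ex) (proj₁ ey) λ where
      0 _ → eq
      1 _ → trans (signal-changes ex) (trans (cong not eq) (sym (signal-changes ey)))
      (suc (suc _)) (s≤s (s≤s ())))
    λ z → mk⇔ id id
  ... | no neq = subst (SameOrbit 2 x) (signal-injective (iterate-hasPeriod (proj₁ ex) 1) (proj₁ ey) λ where
      0 _ → trans (signal-changes ex) (sym (Bool.¬-not (neq ∘ sym)))
      1 _ → trans (cong (λ z → lookup z node₀) (proj₁ ex)) (trans (Bool.¬-not neq) (sym (signal-changes ey)))
      (suc (suc _)) (s≤s (s≤s ())))
    (sameOrbit-iterate (proj₁ ex) (s≤s z≤n))

  alternating : Bool → Config
  alternating b = tabulate (toggle b ∘ delay ∘ toℕ)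

  lookup-alternating : ∀ b {d} i → delay (toℕ i) ≡ d → lookup (alternating b) i ≡ toggle b d
  lookup-alternating b i eq = trans (lookup∘tabulate (toggle b ∘ delay ∘ toℕ) i) (cong (toggle b) eq)

  lookup-alternating-node₀ : ∀ b → lookup (alternating b) node₀ ≡ b
  lookup-alternating-node₀ b = lookup-alternating b node₀ (cong delay toℕ-node₀)

  F-alternating : ∀ b → F (alternating b) ≡ alternating (not b)
  F-alternating b = lookup-ext λ i → trans (go (toℕ i) i refl) (sym (lookup-alternating (not b) i refl))
    where
    open ≡-Reasoning
    toggle-ℓ′ : toggle b ℓ′ ≡ b
    toggle-ℓ′ = Bool.not-injective (toggle-odd b ℓ 2∤ℓ)
    toggle-r′ : toggle b r′ ≡ not b
    toggle-r′ = Bool.not-injective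
      (trans (cong (toggle b) (_∣_.equality 2∣r))
        (trans (toggle-even b (_∣_.quotient 2∣r)) (sym (Bool.not-involutive b))))
    go : ∀ m i → toℕ i ≡ m → lookup (F (alternating b)) i ≡ toggle (not b) (delay m)
    go zero i i≡m = begin
      lookup (F (alternating b)) i
        ≡⟨ F-zero (alternating b) i≡m ⟩
      not (lookup (alternating b) lastLeft) ∨ lookup (alternating b) lastRight
        ≡⟨ cong₂ (λ a c → not a ∨ c)
             (trans (lookup-alternating b lastLeft delay-lastLeft) toggle-ℓ′)
             (trans (lookup-alternating b lastRight delay-lastRight) toggle-r′) ⟩
      not b ∨ not b
        ≡⟨ Bool.∨-idem (not b) ⟩
      not b ∎
    go (suc m) i i≡m with suc m ≟ ℓ
    ... | yes refl = begin
      lookup (F (alternating b)) i     ≡⟨ F-ℓ (alternating b) i≡m ⟩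
      lookup (alternating b) node₀     ≡⟨ lookup-alternating-node₀ b ⟩
      b                                ≡⟨ Bool.not-involutive b ⟨
      not (not b)                      ≡⟨ cong (toggle (not b)) delay-ℓ ⟨
      toggle (not b) (delay ℓ)         ∎
    ... | no m+1≢ℓ = begin
      lookup (F (alternating b)) i
        ≡⟨ F-pred (alternating b) (λ i≡0 → 0≢1+n (trans (sym i≡0) i≡m)) (m+1≢ℓ ∘ trans (sym i≡m)) ⟩
      lookup (alternating b) (Fin.pred i)
        ≡⟨ lookup-alternating b (Fin.pred i) (cong delay (trans (toℕ-pred i) (cong pred i≡m))) ⟩
      toggle b (delay m)                     ≡⟨ Bool.not-involutive _ ⟨
      not (not (toggle b (delay m)))         ≡⟨ cong not (toggle-not b (delay m)) ⟨
      toggle (not b) (suc (delay m))         ≡⟨ cong (toggle (not b)) (delay-suc m+1≢ℓ) ⟨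
      toggle (not b) (delay (suc m))         ∎

  alternating-exact : HasExactPeriod 2 (alternating true)
  alternating-exact = trans (cong F (F-alternating true)) (F-alternating false) , minimal
    where
    minimal : ∀ {d} → d < 2 → 1 ≤ d → ¬ HasPeriod d (alternating true)
    minimal {1} _ _ fixed with () ← trans (sym (lookup-alternating-node₀ false))
      (trans (cong (λ x → lookup x node₀) (trans (sym (F-alternating true)) fixed))
        (lookup-alternating-node₀ true))
    minimal {suc (suc _)} (s≤s (s≤s ())) _

  attractorCount≡1 : attractorCount 2 ≡ 1
  attractorCount≡1 = inhabited-prop⇒≡1
    (proj₁ (Bijection.surjective (attractorCount-correct 2) (alternating true , alternating-exact)))
    (λ i j → Bijection.injective (attractorCount-correct 2) {i} {j}
      (sameOrbit (exact i) (exact j)))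
    where
    exact : ∀ i → HasExactPeriod 2 (proj₁ (Bijection.to (attractorCount-correct 2) i))
    exact i = proj₂ (Bijection.to (attractorCount-correct 2) i)

-- The Möbius sum

[-1]^n≡±1 : ∀ n → -[1+ 0 ] ℤ.^ n ≡ + 1 ⊎ -[1+ 0 ] ℤ.^ n ≡ -[1+ 0 ]
[-1]^n≡±1 zero    = inj₁ refl
[-1]^n≡±1 (suc n) with [-1]^n≡±1 n
... | inj₁ eq = inj₂ (cong (-[1+ 0 ] ℤ.*_) eq)
... | inj₂ eq = inj₁ (cong (-[1+ 0 ] ℤ.*_) eq)

-1≤μ : ∀ n → -[1+ 0 ] ℤ.≤ μ n
-1≤μ zero      = ℤ.-≤+
-1≤μ n@(suc _) with does (unique? _≟_ (factors (factorise n)))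
... | false = ℤ.-≤+
... | true with [-1]^n≡±1 (length (factors (factorise n)))
...   | inj₁ eq = subst (-[1+ 0 ] ℤ.≤_) (sym eq) ℤ.-≤+
...   | inj₂ eq = ℤ.≤-reflexive (sym eq)

möbiusTerm-bound : ∀ p i e → e ℤ.≤ möbiusTerm p i ℤ.+ e ℤ.+ + (2 ^ suc i)
möbiusTerm-bound p i e = begin
  e                                            ≡⟨ cancel e t ⟩
  -[1+ 0 ] ℤ.* t ℤ.+ e ℤ.+ t
    ≤⟨ ℤ.+-monoˡ-≤ t (ℤ.+-monoˡ-≤ e (ℤ.*-monoʳ-≤-nonNeg t (-1≤μ (p / suc i)))) ⟩
  möbiusTerm p i ℤ.+ e ℤ.+ t                   ∎
  where
  open ℤ.≤-Reasoning
  t : ℤ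
  t = + (2 ^ suc i)
  cancel : ∀ e t → e ≡ -[1+ 0 ] ℤ.* t ℤ.+ e ℤ.+ t
  cancel = ℤSolver.solve-∀

möbiusSum : ℕ → ℕ → ℤ → ℤ
möbiusSum p k e = foldr ℤ._+_ e (map (möbiusTerm p) (filter (λ i → suc i ∣? p) (upTo k)))

möbiusSum-suc : ∀ p k e → möbiusSum p (suc k) e ≡
  möbiusSum p k (foldr ℤ._+_ e (map (möbiusTerm p) (filter (λ i → suc i ∣? p) (k ∷ []))))
möbiusSum-suc p k e = begin
  foldr ℤ._+_ e (map t (filter P? (upTo (suc k))))
    ≡⟨ cong (λ is → foldr ℤ._+_ e (map t (filter P? is))) (upTo-∷ʳ k) ⟨
  foldr ℤ._+_ e (map t (filter P? (upTo k ++ k ∷ [])))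
    ≡⟨ cong (λ is → foldr ℤ._+_ e (map t is)) (filter-++ P? (upTo k) (k ∷ [])) ⟩
  foldr ℤ._+_ e (map t (filter P? (upTo k) ++ filter P? (k ∷ [])))
    ≡⟨ cong (foldr ℤ._+_ e) (map-++ t (filter P? (upTo k)) _) ⟩
  foldr ℤ._+_ e (map t (filter P? (upTo k)) ++ map t (filter P? (k ∷ [])))
    ≡⟨ foldr-++ ℤ._+_ e (map t (filter P? (upTo k))) _ ⟩
  möbiusSum p k (foldr ℤ._+_ e (map t (filter P? (k ∷ [])))) ∎
  where
  open ≡-Reasoning
  t = möbiusTerm p
  P? = λ i → suc i ∣? p

möbiusSum-∣ : ∀ p k e → suc k ∣ p → möbiusSum p (suc k) e ≡ möbiusSum p k (möbiusTerm p k ℤ.+ e)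
möbiusSum-∣ p k e k∣p = trans (möbiusSum-suc p k e)
  (cong (λ is → möbiusSum p k (foldr ℤ._+_ e (map (möbiusTerm p) is)))
    (filter-accept (λ i → suc i ∣? p) {xs = []} k∣p))

möbiusSum-∤ : ∀ p k e → ¬ (suc k ∣ p) → möbiusSum p (suc k) e ≡ möbiusSum p k e
möbiusSum-∤ p k e k∤p = trans (möbiusSum-suc p k e)
  (cong (λ is → möbiusSum p k (foldr ℤ._+_ e (map (möbiusTerm p) is)))
    (filter-reject (λ i → suc i ∣? p) {xs = []} k∤p))

möbiusSum-lower : ∀ p k e → e ℤ.< möbiusSum p k e ℤ.+ + (2 ^ suc k)
möbiusSum-lower p zero    e = subst (ℤ._< e ℤ.+ + 2) (ℤ.+-identityʳ e) (ℤ.+-monoʳ-< e (ℤ.+<+ z<s))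
möbiusSum-lower p (suc k) e with suc k ∣? p
... | yes k∣p = begin-strict
  e                                                 ≤⟨ möbiusTerm-bound p k e ⟩
  e′ ℤ.+ t                                          <⟨ ℤ.+-monoˡ-< t (möbiusSum-lower p k e′) ⟩
  möbiusSum p k e′ ℤ.+ t ℤ.+ t                      ≡⟨ double (möbiusSum p k e′) t ⟩
  möbiusSum p k e′ ℤ.+ + 2 ℤ.* t
    ≡⟨ cong₂ ℤ._+_ (möbiusSum-∣ p k e k∣p) (ℤ.pos-* 2 (2 ^ suc k)) ⟨
  möbiusSum p (suc k) e ℤ.+ + (2 ^ suc (suc k))     ∎
  where
  open ℤ.≤-Reasoning
  e′ t : ℤ
  e′ = möbiusTerm p k ℤ.+ e
  t = + (2 ^ suc k)
  double : ∀ s t → s ℤ.+ t ℤ.+ t ≡ s ℤ.+ + 2 ℤ.* t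
  double = ℤSolver.solve-∀
... | no k∤p = begin-strict
  e                                                 <⟨ möbiusSum-lower p k e ⟩
  möbiusSum p k e ℤ.+ + (2 ^ suc k)
    ≤⟨ ℤ.+-monoʳ-≤ (möbiusSum p k e) (ℤ.+≤+ (m≤n*m (2 ^ suc k) 2)) ⟩
  möbiusSum p k e ℤ.+ + (2 ^ suc (suc k))           ≡⟨ cong (ℤ._+ _) (möbiusSum-∤ p k e k∤p) ⟨
  möbiusSum p (suc k) e ℤ.+ + (2 ^ suc (suc k))     ∎
  where open ℤ.≤-Reasoning

-- Every proper divisor of p ≥ 3 is at most p - 2, so the terms other than that
-- of d = p add up to less than 2 ^ (p - 1) in absolute value.
möbiusSum-large : ∀ q → let p = 3 + q in + (2 ^ (2 + q)) ℤ.< möbiusSum p p (+ 0)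
möbiusSum-large q = ℤ.≰⇒> λ S≤t → ℤ.≤⇒≯ (ℤ.+-monoˡ-≤ t S≤t) (begin-strict
  t ℤ.+ t
    ≡⟨ cong +_ (cong (λ m → 2 ^ (2 + q) + m) (sym (+-identityʳ (2 ^ (2 + q))))) ⟩
  + (2 ^ p)                                    <⟨ möbiusSum-lower p (suc q) (+ (2 ^ p)) ⟩
  möbiusSum p (suc q) (+ (2 ^ p)) ℤ.+ t        ≡⟨ cong (ℤ._+ t) step ⟨
  möbiusSum p p (+ 0) ℤ.+ t                    ∎)
  where
  open ℤ.≤-Reasoning
  p = 3 + q
  t : ℤ
  t = + (2 ^ (2 + q))
  p-1∤p : ¬ (2 + q ∣ p)
  p-1∤p d with () ← ∣1⇒≡1 (∣m+n∣m⇒∣n (subst (2 + q ∣_) (+-comm 1 (2 + q)) d) ∣-refl)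
  last-term : möbiusTerm p (2 + q) ℤ.+ + 0 ≡ + (2 ^ p)
  last-term = trans (ℤ.+-identityʳ _)
    (trans (cong (λ m → μ m ℤ.* + (2 ^ p)) (n/n≡1 p)) (ℤ.*-identityˡ (+ (2 ^ p))))
  step : möbiusSum p p (+ 0) ≡ möbiusSum p (suc q) (+ (2 ^ p))
  step = trans (möbiusSum-∣ p (2 + q) (+ 0) ∣-refl)
    (trans (cong (möbiusSum p (2 + q)) last-term) (möbiusSum-∤ p (suc q) (+ (2 ^ p)) p-1∤p))

-- Comparison in ℚ(√3)

ι : ℕ → ℚ
ι n = + n ℚ./ 1

ι-* : ∀ m n → ι (m * n) ≡ ι m ℚ.* ι n
ι-* m n = ℚ.toℚᵘ-injective (begin
  ℚ.toℚᵘ (ι (m * n))                      ≈⟨ ℚ.toℚᵘ-fromℚᵘ (mkℚᵘ (+ (m * n)) 0) ⟩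
  mkℚᵘ (+ (m * n)) 0                      ≡⟨ cong (λ z → mkℚᵘ z 0) (ℤ.pos-* m n) ⟩
  mkℚᵘ (+ m) 0 ℚᵘ.* mkℚᵘ (+ n) 0
    ≈⟨ ℚᵘ.*-cong (ℚ.toℚᵘ-fromℚᵘ (mkℚᵘ (+ m) 0)) (ℚ.toℚᵘ-fromℚᵘ (mkℚᵘ (+ n) 0)) ⟨
  ℚ.toℚᵘ (ι m) ℚᵘ.* ℚ.toℚᵘ (ι n)          ≈⟨ ℚ.toℚᵘ-homo-* (ι m) (ι n) ⟨
  ℚ.toℚᵘ (ι m ℚ.* ι n)                    ∎)
  where open import Relation.Binary.Reasoning.Setoid ℚᵘ.≃-setoid

/-*-cancel : ∀ s p .{{_ : NonZero p}} → (+ s ℚ./ p) ℚ.* ι p ≡ ι s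
/-*-cancel s p@(suc p-1) = ℚ.toℚᵘ-injective (begin
  ℚ.toℚᵘ ((+ s ℚ./ p) ℚ.* ι p)            ≈⟨ ℚ.toℚᵘ-homo-* (+ s ℚ./ p) (ι p) ⟩
  ℚ.toℚᵘ (+ s ℚ./ p) ℚᵘ.* ℚ.toℚᵘ (ι p)
    ≈⟨ ℚᵘ.*-cong (ℚ.toℚᵘ-fromℚᵘ (mkℚᵘ (+ s) p-1)) (ℚ.toℚᵘ-fromℚᵘ (mkℚᵘ (+ p) 0)) ⟩
  mkℚᵘ (+ s) p-1 ℚᵘ.* mkℚᵘ (+ p) 0        ≈⟨ ℚᵘ.*≡* (ℤ.*-assoc (+ s) (+ p) (+ 1)) ⟩
  mkℚᵘ (+ s) 0                            ≈⟨ ℚ.toℚᵘ-fromℚᵘ (mkℚᵘ (+ s) 0) ⟨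
  ℚ.toℚᵘ (ι s)                            ∎)
  where open import Relation.Binary.Reasoning.Setoid ℚᵘ.≃-setoid

ι-mono-< : ∀ {m n} → m < n → ι m ℚ.< ι n
ι-mono-< {m} {n} m<n = ℚ.toℚᵘ-cancel-< (begin-strict
  ℚ.toℚᵘ (ι m)     ≃⟨ ℚ.toℚᵘ-fromℚᵘ (mkℚᵘ (+ m) 0) ⟩
  mkℚᵘ (+ m) 0     <⟨ ℚᵘ.*<* (ℤ.*-monoʳ-<-pos (+ 1) (ℤ.+<+ m<n)) ⟩
  mkℚᵘ (+ n) 0     ≃⟨ ℚ.toℚᵘ-fromℚᵘ (mkℚᵘ (+ n) 0) ⟨
  ℚ.toℚᵘ (ι n)     ∎)
  where open ℚᵘ.≤-Reasoning

0<p-q : ∀ {p q} → p ℚ.< q → 0ℚ ℚ.< q ℚ.- p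
0<p-q {p} {q} p<q = subst (ℚ._< q ℚ.- p) (ℚ.+-inverseʳ p) (ℚ.+-monoˡ-< (ℚ.- p) p<q)

0<p*q : ∀ {p q} → 0ℚ ℚ.< p → 0ℚ ℚ.< q → 0ℚ ℚ.< p ℚ.* q
0<p*q {p} {q} 0<p 0<q = subst (ℚ._< p ℚ.* q) (ℚ.*-zeroˡ q) (ℚ.*-monoˡ-<-pos q {{ℚ.positive 0<q}} 0<p)

cancel-< : ∀ {p q} r → 0ℚ ℚ.< r → p ℚ.* r ℚ.< q ℚ.* r → p ℚ.< q
cancel-< r 0<r = ℚ.*-cancelʳ-<-nonNeg r {{ℚ.pos⇒nonNeg r {{ℚ.positive 0<r}}}}

¾ : ℚ
¾ = + 3 ℚ./ 4

[3/4]^_ : ℕ → ℚ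
[3/4]^ zero  = 1ℚ
[3/4]^ suc k = ¾ ℚ.* [3/4]^ k

private
  2ℚ 3ℚ : ℚ
  2ℚ = + 2 ℚ./ 1
  3ℚ = + 3 ℚ./ 1

[3/4]^-* : ∀ k → [3/4]^ k ℚ.* ι (4 ^ k) ≡ ι (3 ^ k)
[3/4]^-* zero    = refl
[3/4]^-* (suc k) = begin
  ¾ ℚ.* [3/4]^ k ℚ.* ι (4 * 4 ^ k)                ≡⟨ cong (¾ ℚ.* [3/4]^ k ℚ.*_) (ι-* 4 (4 ^ k)) ⟩
  ¾ ℚ.* [3/4]^ k ℚ.* (ι 4 ℚ.* ι (4 ^ k))          ≡⟨ regroup ¾ ([3/4]^ k) (ι 4) (ι (4 ^ k)) ⟩
  ¾ ℚ.* ι 4 ℚ.* ([3/4]^ k ℚ.* ι (4 ^ k))          ≡⟨ cong (3ℚ ℚ.*_) ([3/4]^-* k) ⟩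
  3ℚ ℚ.* ι (3 ^ k)                                ≡⟨ ι-* 3 (3 ^ k) ⟨
  ι (3 * 3 ^ k)                                   ∎
  where
  open ≡-Reasoning
  open +-*-Solver
  regroup : ∀ a b c d → a ℚ.* b ℚ.* (c ℚ.* d) ≡ a ℚ.* c ℚ.* (b ℚ.* d)
  regroup = solve 4 (λ a b c d → a :* b :* (c :* d) := a :* c :* (b :* d)) refl

√3/2 : ℚ√3
√3/2 = √3 ⊗ fromℚ ½

√3/2-⊗-rat : ∀ a → √3/2 ⊗ fromℚ a ≡ 0ℚ +√3· ½ ℚ.* a
√3/2-⊗-rat a = cong₂ _+√3·_
  (solve 1 (λ a → con 0ℚ :* a :+ con 3ℚ :* (con ½ :* con 0ℚ) := con 0ℚ) refl a)
  (solve 1 (λ a → con 0ℚ :* con 0ℚ :+ con ½ :* a := con ½ :* a) refl a)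
  where open +-*-Solver

√3/2-⊗-irr : ∀ a → √3/2 ⊗ (0ℚ +√3· ½ ℚ.* a) ≡ fromℚ (¾ ℚ.* a)
√3/2-⊗-irr a = cong₂ _+√3·_
  (solve 1 (λ a → con 0ℚ :* con 0ℚ :+ con 3ℚ :* (con ½ :* (con ½ :* a)) := con ¾ :* a) refl a)
  (solve 1 (λ a → con 0ℚ :* (con ½ :* a) :+ con ½ :* con 0ℚ := con 0ℚ) refl a)
  where open +-*-Solver

√3/2-↑-even : ∀ k → √3/2 ↑ (k * 2) ≡ fromℚ ([3/4]^ k)
√3/2-↑-odd  : ∀ k → √3/2 ↑ suc (k * 2) ≡ 0ℚ +√3· ½ ℚ.* [3/4]^ k
√3/2-↑-even zero    = refl
√3/2-↑-even (suc k) = trans (cong (√3/2 ⊗_) (√3/2-↑-odd k)) (√3/2-⊗-irr ([3/4]^ k))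
√3/2-↑-odd k = trans (cong (√3/2 ⊗_) (√3/2-↑-even k)) (√3/2-⊗-rat ([3/4]^ k))

difference-rat : ∀ q A N →
  fromℕ 2 ⊗ fromℚ q ⊗ fromℚ A ⊖ fromℚ N ≡ fromℚ (2ℚ ℚ.* (q ℚ.* A) ℚ.- N)
difference-rat q A N = cong₂ _+√3·_
  (solve 3 (λ q A N → (con 2ℚ :* q :+ con 3ℚ :* (con 0ℚ :* con 0ℚ)) :* A
      :+ con 3ℚ :* ((con 2ℚ :* con 0ℚ :+ con 0ℚ :* q) :* con 0ℚ) :- N
    := con 2ℚ :* (q :* A) :- N) refl q A N)
  (solve 2 (λ q A → (con 2ℚ :* q :+ con 3ℚ :* (con 0ℚ :* con 0ℚ)) :* con 0ℚ
      :+ (con 2ℚ :* con 0ℚ :+ con 0ℚ :* q) :* A :- con 0ℚ := con 0ℚ) refl q A)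
  where open +-*-Solver

difference-irr : ∀ q A N →
  fromℕ 2 ⊗ (0ℚ +√3· ½ ℚ.* q) ⊗ fromℚ A ⊖ fromℚ N ≡ (ℚ.- N) +√3· q ℚ.* A
difference-irr q A N = cong₂ _+√3·_
  (solve 3 (λ q A N → (con 2ℚ :* con 0ℚ :+ con 3ℚ :* (con 0ℚ :* (con ½ :* q))) :* A
      :+ con 3ℚ :* ((con 2ℚ :* (con ½ :* q) :+ con 0ℚ :* con 0ℚ) :* con 0ℚ) :- N
    := :- N) refl q A N)
  (solve 2 (λ q A → (con 2ℚ :* con 0ℚ :+ con 3ℚ :* (con 0ℚ :* (con ½ :* q))) :* con 0ℚ
      :+ (con 2ℚ :* (con ½ :* q) :+ con 0ℚ :* con 0ℚ) :* A :- con 0ℚ := q :* A) refl q A)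
  where open +-*-Solver

module _ (N s p k : ℕ) .{{_ : NonZero p}} where

  private
    A q P 4ᵏ : ℚ
    A = + s ℚ./ p
    q = [3/4]^ k
    P = ι p
    4ᵏ = ι (4 ^ k)

    0<P*4ᵏ : 0ℚ ℚ.< P ℚ.* 4ᵏ
    0<P*4ᵏ = 0<p*q (ι-mono-< (>-nonZero⁻¹ p)) (ι-mono-< (m^n>0 4 k))

    q*A-cleared : q ℚ.* A ℚ.* (P ℚ.* 4ᵏ) ≡ ι (3 ^ k * s)
    q*A-cleared = begin
      q ℚ.* A ℚ.* (P ℚ.* 4ᵏ)     ≡⟨ regroup q A P 4ᵏ ⟩
      q ℚ.* 4ᵏ ℚ.* (A ℚ.* P)     ≡⟨ cong₂ ℚ._*_ ([3/4]^-* k) (/-*-cancel s p) ⟩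
      ι (3 ^ k) ℚ.* ι s          ≡⟨ ι-* (3 ^ k) s ⟨
      ι (3 ^ k * s)              ∎
      where
      open ≡-Reasoning
      open +-*-Solver
      regroup : ∀ a b c d → a ℚ.* b ℚ.* (c ℚ.* d) ≡ a ℚ.* d ℚ.* (b ℚ.* c)
      regroup = solve 4 (λ a b c d → a :* b :* (c :* d) := a :* d :* (b :* c)) refl

    N-cleared : ι N ℚ.* (P ℚ.* 4ᵏ) ≡ ι (N * p * 4 ^ k)
    N-cleared = begin
      ι N ℚ.* (P ℚ.* 4ᵏ)         ≡⟨ ℚ.*-assoc (ι N) P 4ᵏ ⟨
      ι N ℚ.* P ℚ.* 4ᵏ           ≡⟨ cong (ℚ._* 4ᵏ) (ι-* N p) ⟨
      ι (N * p) ℚ.* 4ᵏ           ≡⟨ ι-* (N * p) (4 ^ k) ⟨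
      ι (N * p * 4 ^ k)          ∎
      where open ≡-Reasoning

  ⊏-bound-even : N * p * 4 ^ k < 2 * (3 ^ k * s) →
    fromℕ N ⊏ fromℕ 2 ⊗ √3/2 ↑ (k * 2) ⊗ fromℚ A
  ⊏-bound-even lt = subst Positive
    (trans (sym (difference-rat q A (ι N)))
      (cong (λ y → fromℕ 2 ⊗ y ⊗ fromℚ A ⊖ fromℕ N) (sym (√3/2-↑-even k))))
    (rat-dominates 0<d (0<p*q 0<d 0<d))
    where
    N<2qA : ι N ℚ.< 2ℚ ℚ.* (q ℚ.* A)
    N<2qA = cancel-< (P ℚ.* 4ᵏ) 0<P*4ᵏ (subst₂ ℚ._<_ (sym N-cleared)
      (trans (ι-* 2 (3 ^ k * s)) (trans (cong (2ℚ ℚ.*_) (sym q*A-cleared))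
        (sym (ℚ.*-assoc 2ℚ (q ℚ.* A) (P ℚ.* 4ᵏ)))))
      (ι-mono-< lt))
    0<d : 0ℚ ℚ.< 2ℚ ℚ.* (q ℚ.* A) ℚ.- ι N
    0<d = 0<p-q N<2qA

  ⊏-bound-odd : (N * p * 4 ^ k) * (N * p * 4 ^ k) < 3 * ((3 ^ k * s) * (3 ^ k * s)) →
    fromℕ N ⊏ fromℕ 2 ⊗ √3/2 ↑ suc (k * 2) ⊗ fromℚ A
  ⊏-bound-odd lt = subst Positive
    (trans (sym (difference-irr q A (ι N)))
      (cong (λ y → fromℕ 2 ⊗ y ⊗ fromℚ A ⊖ fromℕ N) (sym (√3/2-↑-odd k))))
    (irr-dominates 0<qA N²<3[qA]²)
    where
    0<3ᵏs : 0 < 3 ^ k * s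
    0<3ᵏs = n≢0⇒n>0 λ eq → n≮0 (subst (λ m → (N * p * 4 ^ k) * (N * p * 4 ^ k) < 3 * (m * m)) eq lt)
    0<qA : 0ℚ ℚ.< q ℚ.* A
    0<qA = cancel-< (P ℚ.* 4ᵏ) 0<P*4ᵏ (subst₂ ℚ._<_
      (sym (ℚ.*-zeroˡ (P ℚ.* 4ᵏ))) (sym q*A-cleared) (ι-mono-< 0<3ᵏs))
    open +-*-Solver
    N²<3[qA]² : (ℚ.- ι N) ℚ.* (ℚ.- ι N) ℚ.< 3ℚ ℚ.* (q ℚ.* A ℚ.* (q ℚ.* A))
    N²<3[qA]² = cancel-< ((P ℚ.* 4ᵏ) ℚ.* (P ℚ.* 4ᵏ)) (0<p*q 0<P*4ᵏ 0<P*4ᵏ) (subst₂ ℚ._<_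
      (trans (ι-* (N * p * 4 ^ k) (N * p * 4 ^ k)) (trans (cong (λ z → z ℚ.* z) (sym N-cleared))
        (solve 2 (λ a b → a :* b :* (a :* b) := :- a :* :- a :* (b :* b)) refl (ι N) (P ℚ.* 4ᵏ))))
      (trans (ι-* 3 ((3 ^ k * s) * (3 ^ k * s))) (trans (cong (3ℚ ℚ.*_)
          (trans (ι-* (3 ^ k * s) (3 ^ k * s)) (cong (λ z → z ℚ.* z) (sym q*A-cleared))))
        (solve 2 (λ a b → con 3ℚ :* (a :* b :* (a :* b)) := con 3ℚ :* (a :* a) :* (b :* b)) refl
          (q ℚ.* A) (P ℚ.* 4ᵏ))))
      (ι-mono-< lt))

even∨odd : ∀ n → ∃[ k ] (n ≡ k * 2 ⊎ n ≡ suc (k * 2))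
even∨odd zero = 0 , inj₁ refl
even∨odd (suc n) with even∨odd n
... | k , inj₁ eq = k , inj₂ (cong suc eq)
... | k , inj₂ eq = suc k , inj₁ (cong suc eq)

m^[k*2]≡m^k*m^k : ∀ m k → m ^ (k * 2) ≡ m ^ k * m ^ k
m^[k*2]≡m^k*m^k m k = trans (sym (^-*-assoc m k 2)) (cong (m ^ k *_) (*-identityʳ (m ^ k)))

4^k≡2^[k*2] : ∀ k → 4 ^ k ≡ 2 ^ (k * 2)
4^k≡2^[k*2] k = trans (^-*-assoc 2 2 k) (cong (2 ^_) (*-comm 2 k))

⊏-bound : ∀ N s p .{{_ : NonZero p}} → (N * p) * (N * p) ≤ 3 ^ p → 2 ^ p < 2 * s →
  fromℕ N ⊏ fromℕ 2 ⊗ √3/2 ↑ p ⊗ fromℚ (+ s ℚ./ p)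
⊏-bound N s p [Np]²≤3^p 2^p<2s with even∨odd p
... | k , inj₁ refl = ⊏-bound-even N s p k (begin-strict
  N * p * 4 ^ k
    ≤⟨ *-monoˡ-≤ (4 ^ k) (square-cancel-≤ {N * p} {3 ^ k}
           (≤-trans [Np]²≤3^p (≤-reflexive (m^[k*2]≡m^k*m^k 3 k)))) ⟩
  3 ^ k * 4 ^ k        ≡⟨ cong (3 ^ k *_) (4^k≡2^[k*2] k) ⟩
  3 ^ k * 2 ^ p        <⟨ *-monoʳ-< (3 ^ k) {{m^n≢0 3 k}} 2^p<2s ⟩
  3 ^ k * (2 * s)      ≡⟨ regroup (3 ^ k) s ⟩
  2 * (3 ^ k * s)      ∎)
  where
  open ≤-Reasoning
  regroup : ∀ a s → a * (2 * s) ≡ 2 * (a * s)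
  regroup = solve-∀
... | k , inj₂ refl = ⊏-bound-odd N s p k (begin-strict
  N * p * 4 ^ k * (N * p * 4 ^ k)          ≡⟨ square (N * p) (4 ^ k) ⟩
  N * p * (N * p) * (4 ^ k * 4 ^ k)        ≤⟨ *-monoˡ-≤ (4 ^ k * 4 ^ k) [Np]²≤3^p ⟩
  3 * 3 ^ (k * 2) * (4 ^ k * 4 ^ k)
    <⟨ *-monoʳ-< (3 * 3 ^ (k * 2)) {{m*n≢0 3 (3 ^ (k * 2)) {{_}} {{m^n≢0 3 (k * 2)}}}}
           (*-mono-< 4ᵏ<s 4ᵏ<s) ⟩
  3 * 3 ^ (k * 2) * (s * s)                ≡⟨ cong (λ m → 3 * m * (s * s)) (m^[k*2]≡m^k*m^k 3 k) ⟩
  3 * (3 ^ k * 3 ^ k) * (s * s)            ≡⟨ regroup (3 ^ k) s ⟩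
  3 * (3 ^ k * s * (3 ^ k * s))            ∎)
  where
  open ≤-Reasoning
  4ᵏ<s : 4 ^ k < s
  4ᵏ<s = *-cancelˡ-< 2 _ _ (subst (λ m → 2 * m < 2 * s) (sym (4^k≡2^[k*2] k)) 2^p<2s)
  square : ∀ a b → a * b * (a * b) ≡ a * a * (b * b)
  square = solve-∀
  regroup : ∀ a s → 3 * (a * a) * (s * s) ≡ 3 * (a * s * (a * s))
  regroup = solve-∀

+<⇒+ : ∀ {m z} → + m ℤ.< z → ∃[ n ] z ≡ + n × m < n
+<⇒+ (ℤ.+<+ m<n) = _ , refl , m<n

A⁺-numerator : ∀ q → let p = 3 + q in ∃[ s ] 2 ^ p < 2 * s × A⁺ p ≡ + s ℚ./ p
A⁺-numerator q with s , S≡s , 2^[p-1]<s ← +<⇒+ (möbiusSum-large q) =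
  s , *-monoʳ-< 2 2^[p-1]<s , cong (ℚ._/ (3 + q)) S≡s

A±-bound : ∀ ℓ r p s .{{_ : NonZero ℓ}} .{{_ : NonZero r}} .{{_ : NonZero p}} → p ∣ r → ¬ (p ∣ ℓ) →
  2 ^ p < 2 * s × A⁺ p ≡ + s ℚ./ p →
  fromℕ (A± p ℓ r) ⊏ fromℕ 2 ⊗ √3/2 ↑ p ⊗ fromℚ (A⁺ p)
A±-bound ℓ@(suc ℓ′) r@(suc r′) p s p∣r p∤ℓ (2^p<2s , A⁺≡s/p) =
  subst (λ a → fromℕ (A± p ℓ r) ⊏ fromℕ 2 ⊗ √3/2 ↑ p ⊗ fromℚ a) (sym A⁺≡s/p)
    (⊏-bound (A± p ℓ r) s p (Counting.attractorCount-bound ℓ′ r′ p p∣r p∤ℓ) 2^p<2s)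

A±₂≡1 : ∀ ℓ r .{{_ : NonZero ℓ}} .{{_ : NonZero r}} → 2 ∣ r → ¬ (2 ∣ ℓ) → A± 2 ℓ r ≡ 1
A±₂≡1 (suc ℓ′) (suc r′) = Alternating.attractorCount≡1 ℓ′ r′

proposition5 : ∀ (ℓ r p : ℕ) .{{_ : NonZero ℓ}} .{{_ : NonZero r}} .{{_ : NonZero p}} →
    p ∣ r → ¬ (p ∣ ℓ) →
    (p ≢ 2 → fromℕ (A± p ℓ r) ⊏ fromℕ 2 ⊗ (√3 ⊗ fromℚ ½) ↑ p ⊗ fromℚ (A⁺ p)) ×
    (p ≡ 2 → (A± p ℓ r ≡ 1) × (A⁺ p ≡ 1ℚ))
proposition5 ℓ r 1 _   p∤ℓ = contradiction (1∣ ℓ) p∤ℓ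
proposition5 ℓ r 2 p∣r p∤ℓ = (λ p≢2 → contradiction refl p≢2) , λ _ → A±₂≡1 ℓ r p∣r p∤ℓ , refl
proposition5 ℓ r p@(suc (suc (suc q))) p∣r p∤ℓ =
  (λ _ → A±-bound ℓ r p (proj₁ (A⁺-numerator q)) p∣r p∤ℓ (proj₂ (A⁺-numerator q))) , λ ()
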